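{- Let $L$ be any one of the sequent calculi $\mathrm{LJ}^+$, $\mathrm{sC}$, $\mathrm{sC3}$, $\mathrm{sMC}$, $\mathrm{sCN}$. The weakening rule (we), "from $\Gamma\Rightarrow\gamma$ infer $\alpha,\Gamma\Rightarrow\gamma$", is admissible in cut-free $L$; that is, for every finite set $\Gamma$ of formulas and all formulas $\alpha,\gamma$ (in the language of $L$), if $\Gamma\Rightarrow\gamma$ is provable in $L-(\mathrm{cut})$, then $\alpha,\Gamma\Rightarrow\gamma$ is provable in $L-(\mathrm{cut})$.
   Context: Formulas of $\mathrm{sC},\mathrm{sC3},\mathrm{sMC},\mathrm{sCN}$ are built from countably many propositional variables $p,q,\dots$ using the binary connectives $\land,\lor,\to$ and the unary connective $\sim$; the language of $\mathrm{LJ}^+$ (positive intuitionistic logic) has only $\land,\lor,\to$ and no $\sim$. A sequent is an expression $\Gamma\Rightarrow\gamma$ with $\Gamma$ a finite (possibly empty) set of formulas and $\gamma$ a single formula; $\alpha,\Gamma$ means $\{\alpha\}\cup\Gamma$ and $\Gamma,\Delta$ means $\Gamma\cup\Delta$. $L-(\mathrm{cut})$ ("cut-free $L$") is $L$ without the rule (cut). Below, $p$ is any propositional variable, $\alpha,\beta,\gamma$ any formulas, $\Gamma,\Delta,\Sigma$ any finite sets of formulas. $\mathrm{LJ}^+$ has initial sequents (init1) $p,\Gamma\Rightarrow p$ and rules: (cut): from $\Gamma\Rightarrow\alpha$ and $\alpha,\Sigma\Rightarrow\gamma$ infer $\Gamma,\Sigma\Rightarrow\gamma$. ($\to$left): from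 $\Gamma\Rightarrow\alpha$ and $\beta,\Delta\Rightarrow\gamma$ infer $\alpha\to\beta,\Gamma,\Delta\Rightarrow\gamma$. ($\to$right): from $\alpha,\Gamma\Rightarrow\beta$ infer $\Gamma\Rightarrow\alpha\to\beta$. ($\land$left): from $\alpha,\beta,\Gamma\Rightarrow\gamma$ infer $\alpha\land\beta,\Gamma\Rightarrow\gamma$. ($\land$right): from $\Gamma\Rightarrow\alpha$ and $\Gamma\Rightarrow\beta$ infer $\Gamma\Rightarrow\alpha\land\beta$. ($\lor$left): from $\alpha,\Gamma\Rightarrow\gamma$ and $\beta,\Gamma\Rightarrow\gamma$ infer $\alpha\lor\beta,\Gamma\Rightarrow\gamma$. ($\lor$right1), ($\lor$right2): from $\Gamma\Rightarrow\alpha$ (respectively $\Gamma\Rightarrow\beta$) infer $\Gamma\Rightarrow\alpha\lor\beta$. $\mathrm{sC}$ is $\mathrm{LJ}^+$ (over the full language) plus initial sequents (init2) $\sim p,\Gamma\Rightarrow\sim p$ and rules: ($\sim$left): from $\alpha,\Gamma\Rightarrow\gamma$ infer $\sim\sim\alpha,\Gamma\Rightarrow\gamma$. ($\sim$right): from $\Gamma\Rightarrow\alpha$ infer $\Gamma\Rightarrow\sim\sim\alpha$. ($\sim\to$left): from $\Gamma\Rightarrow\alpha$ and $\sim\beta,\Delta\Rightarrow\gamma$ infer $\sim(\alpha\to\beta),\Gamma,\Delta\Rightarrow\gamma$. ($\sim\to$right): from $\alpha,\Gamma\Rightarrow\sim\beta$ infer $\Gamma\Rightarrow\sim(\alpha\to\beta)$.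 ($\sim\land$left): from $\sim\alpha,\Gamma\Rightarrow\gamma$ and $\sim\beta,\Gamma\Rightarrow\gamma$ infer $\sim(\alpha\land\beta),\Gamma\Rightarrow\gamma$. ($\sim\land$right1), ($\sim\land$right2): from $\Gamma\Rightarrow\sim\alpha$ (respectively $\Gamma\Rightarrow\sim\beta$) infer $\Gamma\Rightarrow\sim(\alpha\land\beta)$. ($\sim\lor$left): from $\sim\alpha,\sim\beta,\Gamma\Rightarrow\gamma$ infer $\sim(\alpha\lor\beta),\Gamma\Rightarrow\gamma$. ($\sim\lor$right): from $\Gamma\Rightarrow\sim\alpha$ and $\Gamma\Rightarrow\sim\beta$ infer $\Gamma\Rightarrow\sim(\alpha\lor\beta)$. Additional rules: (ex-middle): from $\sim\alpha,\Gamma\Rightarrow\gamma$ and $\alpha,\Gamma\Rightarrow\gamma$ infer $\Gamma\Rightarrow\gamma$. (Peirce): from $\alpha\to\beta,\Gamma\Rightarrow\alpha$ infer $\Gamma\Rightarrow\alpha$. $\mathrm{sC3}=\mathrm{sC}+$(ex-middle); $\mathrm{sMC}=\mathrm{sC}+$(Peirce); $\mathrm{sCN}=\mathrm{sC3}+$(Peirce). -}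

module Defs where

open import Level using (0ℓ)
open import Data.List.Base using (List; []; _∷_; _++_)
open import Data.List.Relation.Binary.BagAndSetEquality using (_∼[_]_; set)
open import Data.List.Relation.Unary.All using (All)
open import Data.Nat.Base using (ℕ)
open import Data.Product.Base using (_×_)
open import Relation.Binary.Construct.Union using (_∪_)
open import Relation.Binary.Core using (REL)
open import Relation.Binary.PropositionalEquality.Core using (_≡_)

infix  9 ∼_
infixr 8 _∧_
infixr 7 _∨_
infixr 6 _⊃_
infix  4 _⇒_ _≋_
infix 10 _−cut

data Language : Set where
  positive full : Language

-- _⊃_ is the implication connective (→ is reserved in Agda).
data Formula : Language → Set where
  var         : ∀ {ℓ} → ℕ → Formula ℓ
  _∧_ _∨_ _⊃_ : ∀ {ℓ} → Formula ℓ → Formula ℓ → Formula ℓ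
  ∼_          : Formula full → Formula full

-- The list in the antecedent stands for the finite set of its elements:
-- α ∷ Γ is {α} ∪ Γ and Γ ++ Δ is Γ ∪ Δ.
record Sequent (ℓ : Language) : Set where
  constructor _⇒_
  field
    antecedent : List (Formula ℓ)
    succedent  : Formula ℓ

open Sequent public

-- Equality of sequents: equal sets on the left, the same formula on the right.
_≋_ : ∀ {ℓ} → Sequent ℓ → Sequent ℓ → Set
s ≋ t = (antecedent s ∼[ set ] antecedent t) × (succedent s ≡ succedent t)

-- R ps s says that s follows from the premises ps by one instance of a rule in
-- R; an initial sequent is a rule without premises.
Rules : Language → Set₁
Rules ℓ = REL (List (Sequent ℓ)) (Sequent ℓ) 0ℓ

variable
  ℓ     : Language
  p     : ℕ
  α β γ : Formula ℓ
  Γ Δ Σ : List (Formula ℓ)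

data CutRule {ℓ : Language} : Rules ℓ where
  cut : CutRule ((Γ ⇒ α) ∷ (α ∷ Σ ⇒ γ) ∷ []) (Γ ++ Σ ⇒ γ)

data PositiveRules {ℓ : Language} : Rules ℓ where
  init1   : PositiveRules [] (var p ∷ Γ ⇒ var p)
  →left   : PositiveRules ((Γ ⇒ α) ∷ (β ∷ Δ ⇒ γ) ∷ []) ((α ⊃ β) ∷ Γ ++ Δ ⇒ γ)
  →right  : PositiveRules ((α ∷ Γ ⇒ β) ∷ []) (Γ ⇒ α ⊃ β)
  ∧left   : PositiveRules ((α ∷ β ∷ Γ ⇒ γ) ∷ []) ((α ∧ β) ∷ Γ ⇒ γ)
  ∧right  : PositiveRules ((Γ ⇒ α) ∷ (Γ ⇒ β) ∷ []) (Γ ⇒ α ∧ β)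
  ∨left   : PositiveRules ((α ∷ Γ ⇒ γ) ∷ (β ∷ Γ ⇒ γ) ∷ []) ((α ∨ β) ∷ Γ ⇒ γ)
  ∨right1 : PositiveRules ((Γ ⇒ α) ∷ []) (Γ ⇒ α ∨ β)
  ∨right2 : PositiveRules ((Γ ⇒ β) ∷ []) (Γ ⇒ α ∨ β)

data NegationRules : Rules full where
  init2    : NegationRules [] (∼ var p ∷ Γ ⇒ ∼ var p)
  ∼left    : NegationRules ((α ∷ Γ ⇒ γ) ∷ []) (∼ ∼ α ∷ Γ ⇒ γ)
  ∼right   : NegationRules ((Γ ⇒ α) ∷ []) (Γ ⇒ ∼ ∼ α)
  ∼→left   : NegationRules ((Γ ⇒ α) ∷ (∼ β ∷ Δ ⇒ γ) ∷ []) (∼ (α ⊃ β) ∷ Γ ++ Δ ⇒ γ)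
  ∼→right  : NegationRules ((α ∷ Γ ⇒ ∼ β) ∷ []) (Γ ⇒ ∼ (α ⊃ β))
  ∼∧left   : NegationRules ((∼ α ∷ Γ ⇒ γ) ∷ (∼ β ∷ Γ ⇒ γ) ∷ []) (∼ (α ∧ β) ∷ Γ ⇒ γ)
  ∼∧right1 : NegationRules ((Γ ⇒ ∼ α) ∷ []) (Γ ⇒ ∼ (α ∧ β))
  ∼∧right2 : NegationRules ((Γ ⇒ ∼ β) ∷ []) (Γ ⇒ ∼ (α ∧ β))
  ∼∨left   : NegationRules ((∼ α ∷ ∼ β ∷ Γ ⇒ γ) ∷ []) (∼ (α ∨ β) ∷ Γ ⇒ γ)
  ∼∨right  : NegationRules ((Γ ⇒ ∼ α) ∷ (Γ ⇒ ∼ β) ∷ []) (Γ ⇒ ∼ (α ∨ β))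

data ExMiddleRule : Rules full where
  ex-middle : ExMiddleRule ((∼ α ∷ Γ ⇒ γ) ∷ (α ∷ Γ ⇒ γ) ∷ []) (Γ ⇒ γ)

data PeirceRule : Rules full where
  peirce : PeirceRule (((α ⊃ β) ∷ Γ ⇒ α) ∷ []) (Γ ⇒ α)

data Calculus : Set where
  LJ⁺ sC sC3 sMC sCN : Calculus

language : Calculus → Language
language LJ⁺ = positive
language sC  = full
language sC3 = full
language sMC = full
language sCN = full

sC-rules sC3-rules : Rules full
sC-rules  = PositiveRules ∪ NegationRules
sC3-rules = sC-rules ∪ ExMiddleRule

_−cut : (L : Calculus) → Rules (language L)
LJ⁺ −cut = PositiveRules
sC  −cut = sC-rules
sC3 −cut = sC3-rules
sMC −cut = sC-rules ∪ PeirceRule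
sCN −cut = sC3-rules ∪ PeirceRule

rules : (L : Calculus) → Rules (language L)
rules L = L −cut ∪ CutRule

-- Since antecedents are sets, the conclusion of a rule instance need only be
-- equal to the sequent derived up to _≋_; this makes provability invariant
-- under _≋_, and so independent of the lists representing the antecedents.
data Provable {ℓ : Language} (R : Rules ℓ) : Sequent ℓ → Set where
  infer : ∀ {ps s t} → R ps s → s ≋ t → All (Provable R) ps → Provable R t

module Submission where

open import Defs
open import Data.List.Base using (List; []; _∷_; _++_; [_]; map)
open import Data.List.Relation.Binary.BagAndSetEquality
  using (set; _∼[_]_; commutativeMonoid; ++-cong; ++-idempotent)
open import Data.List.Relation.Unary.All using (All; []; _∷_)
open import Data.Product.Base using (∃; _×_; _,_)
open import Data.Sum.Base using (inj₁; inj₂)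
open import Level using (0ℓ)
open import Relation.Binary.Construct.Union using (_∪_)
open import Relation.Binary.PropositionalEquality.Core using (refl; trans)
import Algebra.Bundles as Algebra
import Algebra.Properties.CommutativeSemigroup as CommutativeSemigroupProperties

module ++ {ℓ : Language} = Algebra.CommutativeMonoid (commutativeMonoid {a = 0ℓ} set (Formula ℓ))

≋-refl : {s : Sequent ℓ} → s ≋ s
≋-refl = ++.refl , refl

≋-trans : {s t u : Sequent ℓ} → s ≋ t → t ≋ u → s ≋ u
≋-trans (e , p) (f , q) = ++.trans e f , trans p q

++-distribʳ-++ : (Σ Γ Δ : List (Formula ℓ)) →
  ((Γ ++ Σ) ++ (Δ ++ Σ)) ∼[ set ] ((Γ ++ Δ) ++ Σ)
++-distribʳ-++ Σ Γ Δ =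
  ++.trans (interchange Γ Σ Δ Σ) (++.∙-congˡ {x = Γ ++ Δ} (++-idempotent Σ))
  where open CommutativeSemigroupProperties ++.commutativeSemigroup using (interchange)

-- Appending on the right makes (α ∷ Γ) ++ Σ reduce to α ∷ (Γ ++ Σ), so
-- principal and auxiliary formulas stay in place.
weaken : List (Formula ℓ) → Sequent ℓ → Sequent ℓ
weaken Σ (Γ ⇒ γ) = Γ ++ Σ ⇒ γ

weaken-cong : (Σ : List (Formula ℓ)) {s t : Sequent ℓ} → s ≋ t → weaken Σ s ≋ weaken Σ t
weaken-cong Σ (e , p) = ++-cong e (++.refl {x = Σ}) , p

-- t is weaken Σ s except for →left and ∼→left, where merging the contexts of
-- the two premises repeats Σ.
WeakeningClosed : Rules ℓ → Set
WeakeningClosed R = ∀ Σ {ps s} → R ps s →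
  ∃ λ t → R (map (weaken Σ) ps) t × t ≋ weaken Σ s

provable-resp-≋ : {R : Rules ℓ} {s t : Sequent ℓ} → s ≋ t → Provable R s → Provable R t
provable-resp-≋ e (infer r f ds) = infer r (≋-trans f e) ds

module _ {R : Rules ℓ} (closed : WeakeningClosed R) (Σ : List (Formula ℓ)) where

  provable-weaken : ∀ {s} → Provable R s → Provable R (weaken Σ s)
  all-provable-weaken : ∀ {ps} → All (Provable R) ps → All (Provable R) (map (weaken Σ) ps)

  provable-weaken (infer r e ds) with _ , r′ , f ← closed Σ r =
    infer r′ (≋-trans f (weaken-cong Σ e)) (all-provable-weaken ds)

  all-provable-weaken []       = []
  all-provable-weaken (d ∷ ds) = provable-weaken d ∷ all-provable-weaken ds

∪-weakeningClosed : {R S : Rules ℓ} →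
  WeakeningClosed R → WeakeningClosed S → WeakeningClosed (R ∪ S)
∪-weakeningClosed R-closed S-closed Σ (inj₁ r) with t , r′ , e ← R-closed Σ r = t , inj₁ r′ , e
∪-weakeningClosed R-closed S-closed Σ (inj₂ r) with t , r′ , e ← S-closed Σ r = t , inj₂ r′ , e

positive-weakeningClosed : WeakeningClosed (PositiveRules {ℓ})
positive-weakeningClosed Σ init1   = _ , init1 , ≋-refl
positive-weakeningClosed Σ (→left {Γ = Γ} {Δ = Δ}) =
  _ , →left , ++.∙-congˡ {x = [ _ ]} (++-distribʳ-++ Σ Γ Δ) , refl
positive-weakeningClosed Σ →right  = _ , →right , ≋-refl
positive-weakeningClosed Σ ∧left   = _ , ∧left , ≋-refl
positive-weakeningClosed Σ ∧right  = _ , ∧right , ≋-refl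
positive-weakeningClosed Σ ∨left   = _ , ∨left , ≋-refl
positive-weakeningClosed Σ ∨right1 = _ , ∨right1 , ≋-refl
positive-weakeningClosed Σ ∨right2 = _ , ∨right2 , ≋-refl

negation-weakeningClosed : WeakeningClosed NegationRules
negation-weakeningClosed Σ init2    = _ , init2 , ≋-refl
negation-weakeningClosed Σ ∼left    = _ , ∼left , ≋-refl
negation-weakeningClosed Σ ∼right   = _ , ∼right , ≋-refl
negation-weakeningClosed Σ (∼→left {Γ = Γ} {Δ = Δ}) =
  _ , ∼→left , ++.∙-congˡ {x = [ _ ]} (++-distribʳ-++ Σ Γ Δ) , refl
negation-weakeningClosed Σ ∼→right  = _ , ∼→right , ≋-refl
negation-weakeningClosed Σ ∼∧left   = _ , ∼∧left , ≋-refl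
negation-weakeningClosed Σ ∼∧right1 = _ , ∼∧right1 , ≋-refl
negation-weakeningClosed Σ ∼∧right2 = _ , ∼∧right2 , ≋-refl
negation-weakeningClosed Σ ∼∨left   = _ , ∼∨left , ≋-refl
negation-weakeningClosed Σ ∼∨right  = _ , ∼∨right , ≋-refl

exMiddle-weakeningClosed : WeakeningClosed ExMiddleRule
exMiddle-weakeningClosed Σ ex-middle = _ , ex-middle , ≋-refl

peirce-weakeningClosed : WeakeningClosed PeirceRule
peirce-weakeningClosed Σ peirce = _ , peirce , ≋-refl

sC-weakeningClosed : WeakeningClosed sC-rules
sC-weakeningClosed = ∪-weakeningClosed positive-weakeningClosed negation-weakeningClosed

sC3-weakeningClosed : WeakeningClosed sC3-rules
sC3-weakeningClosed = ∪-weakeningClosed sC-weakeningClosed exMiddle-weakeningClosed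

−cut-weakeningClosed : (L : Calculus) → WeakeningClosed (L −cut)
−cut-weakeningClosed LJ⁺ = positive-weakeningClosed
−cut-weakeningClosed sC  = sC-weakeningClosed
−cut-weakeningClosed sC3 = sC3-weakeningClosed
−cut-weakeningClosed sMC = ∪-weakeningClosed sC-weakeningClosed peirce-weakeningClosed
−cut-weakeningClosed sCN = ∪-weakeningClosed sC3-weakeningClosed peirce-weakeningClosed

proposition2p4 : (L : Calculus) (Γ : List (Formula (language L))) (α γ : Formula (language L)) →
    Provable (L −cut) (Γ ⇒ γ) → Provable (L −cut) (α ∷ Γ ⇒ γ)
proposition2p4 L Γ α γ d =
  provable-resp-≋ (++.comm Γ [ α ] , refl) (provable-weaken (−cut-weakeningClosed L) [ α ] d)
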